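{- There is a constant $c>0$ such that for every positive integer $k$ there is an infinite family $\mathcal{G}_k$ of graphs such that $\{\chi(G^k): G\in\mathcal{G}_k\}$ is unbounded and every $G\in\mathcal{G}_k$ satisfies \[ \chi_{\ell}(G^k) \geq c\, \chi(G^k) \log \chi(G^k). \] (The constant $c$ does not depend on $k$.)
   Context: Graphs are finite and simple. The $k$th power $G^k$ of a graph $G$ is the graph on the same vertex set in which two distinct vertices $u,v$ are adjacent if and only if the distance from $u$ to $v$ in $G$ is at most $k$. $\chi$ denotes the chromatic number. The list-chromatic number $\chi_{\ell}(G)$ is the least $t$ such that for any assignment of lists of size $t$ to the vertices of $G$ there is a proper coloring of $V(G)$ in which the color of each vertex belongs to that vertex's list. $\log$ is the natural logarithm. -}

module Defs where

open import Data.Nat.Base as ℕ using (ℕ; zero; suc)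
import Data.Nat.Properties as ℕ
open import Data.Fin.Base as Fin using (Fin; zero; suc; toℕ; combine; finToFun; funToFin)
import Data.Fin.Properties as Fin
open import Data.Integer.Base as ℤ using (+_)
import Data.Integer.Properties as ℤ
open import Data.Rational.Base as ℚ using (ℚ; 0ℚ; 1ℚ; ∣_∣; _/_)
import Data.Rational.Properties as ℚ
open import Data.Rational.Solver using (module +-*-Solver)
import Data.Rational.Unnormalised.Base as ℚᵘ
import Data.Rational.Unnormalised.Properties as ℚᵘ
open import Data.List.Base using (List)
open import Data.List.Relation.Unary.All using (All)
open import Data.Vec.Base using (Vec; lookup; tabulate)
import Data.Vec.Properties as Vec
open import Data.Vec.Membership.Propositional using (_∈_)
open import Data.Vec.Membership.Propositional.Properties using (∈-lookup)
import Data.Vec.Relation.Unary.Any as Any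
open import Data.Vec.Relation.Unary.Any.Properties using (lookup-index)
open import Data.Vec.Relation.Unary.Unique.Propositional using (Unique)
open import Data.Vec.Relation.Unary.Unique.Propositional.Properties using (tabulate⁺; lookup-injective)
open import Data.Product.Base using (Σ; ∃; ∃₂; _×_; _,_; proj₁; proj₂)
open import Data.Sum.Base using (inj₁; inj₂)
open import Function.Base using (_∘_; id)
open import Function.Bundles using (_⇔_; _⤖_; module Bijection)
open import Function.Definitions using (Injective)
open import Level using (0ℓ)
open import Relation.Binary.Core using (Rel)
open import Relation.Binary.Definitions using (Decidable; Symmetric; Irreflexive)
open import Relation.Binary.PropositionalEquality
  using (_≡_; _≢_; _≗_; refl; sym; trans; cong; subst; module ≡-Reasoning)
open import Relation.Nullary using (¬_; Dec; yes; no; contradiction)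
open import Relation.Nullary.Decidable using (map′; ¬?; _×-dec_; _→-dec_)
import Relation.Unary as U
open U using (Pred)

IsLeast : Pred ℕ 0ℓ → Pred ℕ 0ℓ
IsLeast P n = P n × (∀ m → P m → n ℕ.≤ m)

Unbounded : ∀ {ℓ} → Pred ℕ ℓ → Set ℓ
Unbounded S = ∀ N → ∃ λ n → S n × N ℕ.< n

leastAux : {P : Pred ℕ 0ℓ} → U.Decidable P → ∀ d a → P (a ℕ.+ d) →
           (∀ m → P m → a ℕ.≤ m) → ∃ (IsLeast P)
leastAux P? d a p low with P? a
leastAux P? d a p low | yes pa = a , pa , low
leastAux {P} P? zero a p low | no ¬pa = contradiction (subst P (ℕ.+-identityʳ a) p) ¬pa
leastAux {P} P? (suc d) a p low | no ¬pa =
  leastAux P? d (suc a) (subst P (ℕ.+-suc a d) p)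
    λ m pm → ℕ.≤∧≢⇒< (low m pm) λ { refl → ¬pa pm }

least : {P : Pred ℕ 0ℓ} → U.Decidable P → ∃ P → ∃ (IsLeast P)
least P? (n , p) = leastAux P? n 0 p λ _ _ → ℕ.z≤n

record Graph : Set₁ where
  infix 4 _~_ _~?_
  field
    order    : ℕ
    _~_      : Rel (Fin order) 0ℓ
    ~-irrefl : Irreflexive _≡_ _~_
    ~-sym    : Symmetric _~_
    _~?_     : Decidable _~_

  Vertex : Set
  Vertex = Fin order

infix 4 _≅_

_≅_ : Graph → Graph → Set
G ≅ H = Σ (G.Vertex ⤖ H.Vertex) λ φ →
          ∀ u v → (u G.~ v) ⇔ (Bijection.to φ u H.~ Bijection.to φ v)
  where
  module G = Graph G
  module H = Graph H

-- No finite list of graphs contains all members up to isomorphism.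
InfiniteFamily : ∀ {ℓ} → Pred Graph ℓ → Set _
InfiniteFamily 𝒢 = ∀ (Hs : List Graph) → ∃ λ G → 𝒢 G × All (λ H → ¬ (G ≅ H)) Hs

module _ (G : Graph) where
  open Graph G

  data Walk : Vertex → Vertex → ℕ → Set where
    []  : ∀ {v} → Walk v v 0
    _∷_ : ∀ {u v w l} → u ~ v → Walk v w l → Walk u w (suc l)

  IsDistance : Vertex → Vertex → Pred ℕ 0ℓ
  IsDistance u v = IsLeast (Walk u v)

  -- False when u and v lie in different components (infinite distance).
  DistanceAtMost : ℕ → Rel Vertex 0ℓ
  DistanceAtMost k u v = ∃ λ d → IsDistance u v d × d ℕ.≤ k

  walk? : ∀ u v → U.Decidable (Walk u v)
  walk? u v zero    = map′ (λ { refl → [] }) (λ { [] → refl }) (u Fin.≟ v)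
  walk? u v (suc l) = map′ (λ (_ , e , p) → e ∷ p) (λ { (e ∷ p) → _ , e , p })
                           (Fin.any? λ w → (u ~? w) ×-dec walk? w v l)

  snoc : ∀ {u v w l} → Walk u v l → v ~ w → Walk u w (suc l)
  snoc []      e = e ∷ []
  snoc (d ∷ p) e = d ∷ snoc p e

  reverse : ∀ {u v l} → Walk u v l → Walk v u l
  reverse []      = []
  reverse (e ∷ p) = snoc (reverse p) (~-sym e)

  distanceAtMost-sym : ∀ k → Symmetric (DistanceAtMost k)
  distanceAtMost-sym k (d , (p , low) , d≤k) =
    d , (reverse p , λ m q → low m (reverse q)) , d≤k

  -- A walk of length at most k is enough, since then a shortest one exists.
  walk⇒distanceAtMost : ∀ {k u v l} → Walk u v l → l ℕ.≤ k → DistanceAtMost k u v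
  walk⇒distanceAtMost {u = u} {v} p l≤k with least (walk? u v) (_ , p)
  ... | d , q , low = d , (q , low) , ℕ.≤-trans (low _ p) l≤k

  distanceAtMost? : ∀ k → Decidable (DistanceAtMost k)
  distanceAtMost? k u v =
    map′ (λ (l , p) → walk⇒distanceAtMost p (ℕ.s≤s⁻¹ (Fin.toℕ<n l)))
         (λ (d , (p , _) , d≤k) → Fin.fromℕ< (ℕ.s≤s d≤k) ,
            subst (Walk u v) (sym (Fin.toℕ-fromℕ< (ℕ.s≤s d≤k))) p)
         (Fin.any? {n = suc k} λ l → walk? u v (toℕ l))

infixl 8 _^ᵍ_

_^ᵍ_ : Graph → ℕ → Graph
G ^ᵍ k = record
  { order    = order
  ; _~_      = λ u v → u ≢ v × DistanceAtMost G k u v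
  ; ~-irrefl = λ { refl (u≢u , _) → u≢u refl }
  ; ~-sym    = λ (u≢v , p) → u≢v ∘ sym , distanceAtMost-sym G k p
  ; _~?_     = λ u v → ¬? (u Fin.≟ v) ×-dec distanceAtMost? G k u v
  }
  where open Graph G

anyFun? : ∀ {m n} {P : Pred (Fin m → Fin n) 0ℓ} → (∀ {f g} → f ≗ g → P f → P g) →
          U.Decidable P → Dec (∃ P)
anyFun? resp P? =
  map′ (λ (i , p) → finToFun i , p)
       (λ (f , p) → funToFin f , resp (λ x → sym (Fin.finToFun-funToFin f x)) p)
       (Fin.any? (P? ∘ finToFun))

allFun? : ∀ {m n} {P : Pred (Fin m → Fin n) 0ℓ} → (∀ {f g} → f ≗ g → P f → P g) →
          U.Decidable P → Dec (∀ f → P f)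
allFun? resp P? =
  map′ (λ h f → resp (Fin.finToFun-funToFin f) (h (funToFin f)))
       (λ h i → h (finToFun i))
       (Fin.all? (P? ∘ finToFun))

module _ (G : Graph) where
  open Graph G

  IsProper : {C : Set} → (Vertex → C) → Set
  IsProper f = ∀ u v → u ~ v → f u ≢ f v

  Colorable : Pred ℕ 0ℓ
  Colorable t = ∃ λ (f : Vertex → Fin t) → IsProper f

  -- A finite list assignment uses finitely many colors, so natural numbers
  -- suffice as colors. A list of size t has t distinct entries.
  ListAssignment : ℕ → Set
  ListAssignment t = Σ (Vertex → Vec ℕ t) λ L → ∀ v → Unique (L v)

  ListColorable : ∀ {t} → (Vertex → Vec ℕ t) → Set
  ListColorable L = ∃ λ (f : Vertex → ℕ) → IsProper f × (∀ v → f v ∈ L v)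

  Choosable : Pred ℕ 0ℓ
  Choosable t = ∀ (L : ListAssignment t) → ListColorable (proj₁ L)

  IsProper-resp : {C : Set} {f g : Vertex → C} → f ≗ g → IsProper f → IsProper g
  IsProper-resp f≗g p u v e gu≡gv = p u v e (trans (f≗g u) (trans gu≡gv (sym (f≗g v))))

  isProper? : {C : Set} → Decidable {A = C} _≡_ → (f : Vertex → C) → Dec (IsProper f)
  isProper? _≟_ f = Fin.all? λ u → Fin.all? λ v → (u ~? v) →-dec ¬? (f u ≟ f v)

  colorable? : U.Decidable Colorable
  colorable? t = anyFun? IsProper-resp (isProper? Fin._≟_)

  colorable-order : Colorable order
  colorable-order = id , λ u v u~v u≡v → ~-irrefl u≡v u~v

  chromatic-exists : ∃ (IsLeast Colorable)
  chromatic-exists = least colorable? (order , colorable-order)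

  choice : ∀ {t} → (Vertex → Vec ℕ t) → (Vertex → Fin t) → Vertex → ℕ
  choice L i v = lookup (L v) (i v)

  choice⇒ListColorable : ∀ {t} (L : Vertex → Vec ℕ t) →
                         ∃ (IsProper ∘ choice L) → ListColorable L
  choice⇒ListColorable L (i , p) = choice L i , p , λ v → ∈-lookup (i v) (L v)

  ListColorable⇒choice : ∀ {t} (L : Vertex → Vec ℕ t) →
                         ListColorable L → ∃ (IsProper ∘ choice L)
  ListColorable⇒choice L (f , p , f∈L) =
    (λ v → Any.index (f∈L v)) , IsProper-resp (λ v → lookup-index (f∈L v)) p

  listColorable? : ∀ {t} (L : Vertex → Vec ℕ t) → Dec (ListColorable L)
  listColorable? L =
    map′ (choice⇒ListColorable L) (ListColorable⇒choice L)
         (anyFun? (λ i≗j → IsProper-resp (λ v → cong (lookup (L v)) (i≗j v)))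
                  (isProper? ℕ._≟_ ∘ choice L))

  -- Choosability is decidable: the at most order * t colors occurring in the
  -- lists can be renamed into a palette of fixed finite size.
  module Palette (t : ℕ) where

    size : ℕ
    size = suc (order ℕ.* t)

    decode : (Vertex → Fin (size ℕ.^ t)) → Vertex → Vec ℕ t
    decode c v = tabulate (toℕ ∘ finToFun {size} {t} (c v))

    ChoosableWithin : Set
    ChoosableWithin = ∀ c → (∀ v → Injective _≡_ _≡_ (finToFun {size} {t} (c v))) →
                      ListColorable (decode c)

    injective? : ∀ {m n} (f : Fin m → Fin n) → Dec (Injective _≡_ _≡_ f)
    injective? f =
      map′ (λ h {i} {j} → h i j) (λ h i j → h {i} {j})
           (Fin.all? λ i → Fin.all? λ j → (f i Fin.≟ f j) →-dec (i Fin.≟ j))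

    choosableWithin? : Dec ChoosableWithin
    choosableWithin? = allFun? resp λ c →
      Fin.all? (λ v → injective? (finToFun {size} {t} (c v))) →-dec listColorable? (decode c)
      where
      resp : ∀ {c d} → c ≗ d →
             ((∀ v → Injective _≡_ _≡_ (finToFun {size} {t} (c v))) → ListColorable (decode c)) →
             ((∀ v → Injective _≡_ _≡_ (finToFun {size} {t} (d v))) → ListColorable (decode d))
      resp c≗d h inj
        with f , p , f∈ ← h (λ v → subst (λ x → Injective _≡_ _≡_ (finToFun {size} {t} x))
                                         (sym (c≗d v)) (inj v))
        = f , p , λ v → subst (λ x → f v ∈ tabulate (toℕ ∘ finToFun {size} {t} x)) (c≗d v) (f∈ v)

    to : Choosable t → ChoosableWithin
    to h c inj = h (decode c , λ v → tabulate⁺ (λ eq → inj v (Fin.toℕ-injective eq)))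

    from : ChoosableWithin → Choosable t
    from h (L , unique) = choice⇒ListColorable L (i , proper)
      where
      color : Fin (order ℕ.* t) → ℕ
      color j = let v , i = Fin.remQuot {order} t j in lookup (L v) i

      name : ℕ → Fin size
      name x with Fin.any? (λ j → color j ℕ.≟ x)
      ... | yes (j , _) = suc j
      ... | no _        = zero

      unname : Fin size → ℕ
      unname zero    = 0
      unname (suc j) = color j

      unname-name : ∀ v i → unname (name (lookup (L v) i)) ≡ lookup (L v) i
      unname-name v i with Fin.any? (λ j → color j ℕ.≟ lookup (L v) i)
      ... | yes (_ , eq) = eq
      ... | no ¬p = contradiction
        (combine v i , cong (λ (w , j) → lookup (L w) j) (Fin.remQuot-combine {order} v i)) ¬p

      N : Vertex → Fin t → Fin size
      N v i = name (lookup (L v) i)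

      code : Vertex → Fin (size ℕ.^ t)
      code v = funToFin (N v)

      code≗ : ∀ v → finToFun (code v) ≗ N v
      code≗ v = Fin.finToFun-funToFin (N v)

      injective : ∀ v → Injective _≡_ _≡_ (finToFun {size} {t} (code v))
      injective v {i} {j} eq = lookup-injective (unique v) i j
        (trans (sym (unname-name v i))
        (trans (cong unname (trans (sym (code≗ v i)) (trans eq (code≗ v j))))
               (unname-name v j)))

      colored : ∃ (IsProper ∘ choice (decode code))
      colored = ListColorable⇒choice (decode code) (h code injective)

      i : Vertex → Fin t
      i = proj₁ colored

      value : ∀ v → choice (decode code) i v ≡ toℕ (name (choice L i v))
      value v = trans (Vec.lookup∘tabulate _ (i v)) (cong toℕ (code≗ v (i v)))

      proper : IsProper (choice L i)
      proper u v e eq = proj₂ colored u v e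
        (trans (value u) (trans (cong (toℕ ∘ name) eq) (sym (value v))))

  choosable? : U.Decidable Choosable
  choosable? t = map′ from to choosableWithin?
    where open Palette t

  choosable-order : Choosable order
  choosable-order (L , unique) =
    let f , inj , f∈L = distinct order ℕ.≤-refl L unique
    in  f , (λ u v e eq → ~-irrefl (inj eq) e) , f∈L
    where
    distinct : ∀ {t} k → k ℕ.≤ t → (L : Fin k → Vec ℕ t) → (∀ v → Unique (L v)) →
               ∃ λ f → Injective _≡_ _≡_ f × (∀ v → f v ∈ L v)
    distinct zero k≤t L unique = (λ ()) , (λ { {()} }) , λ ()
    distinct {t} (suc k) k<t L unique
      with f , inj , f∈ ← distinct k (ℕ.<⇒≤ k<t) (L ∘ suc) (unique ∘ suc)
      with Fin.all? (λ i → Fin.any? (λ v → f v ℕ.≟ lookup (L zero) i))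
    ... | yes h with i , j , i<j , eq ← Fin.pigeonhole k<t (proj₁ ∘ h) =
      contradiction (lookup-injective (unique zero) i j
        (trans (sym (proj₂ (h i))) (trans (cong f eq) (proj₂ (h j))))) (Fin.<⇒≢ i<j)
    ... | no ¬h with i , new ← Fin.¬∀⟶∃¬ t _ (λ i → Fin.any? (λ v → f v ℕ.≟ lookup (L zero) i)) ¬h
      = g , g-inj , λ { zero → ∈-lookup i (L zero) ; (suc v) → f∈ v }
      where
      g : Fin (suc k) → ℕ
      g zero    = lookup (L zero) i
      g (suc v) = f v

      g-inj : Injective _≡_ _≡_ g
      g-inj {zero}  {zero}  eq = refl
      g-inj {zero}  {suc v} eq = contradiction (v , sym eq) new
      g-inj {suc u} {zero}  eq = contradiction (u , eq) new
      g-inj {suc u} {suc v} eq = cong suc (inj eq)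

  listChromatic-exists : ∃ (IsLeast Choosable)
  listChromatic-exists = least choosable? (order , choosable-order)

abstract
  χ : Graph → ℕ
  χ G = proj₁ (chromatic-exists G)

  χ-isLeast : ∀ G → IsLeast (Colorable G) (χ G)
  χ-isLeast G = proj₂ (chromatic-exists G)

  χℓ : Graph → ℕ
  χℓ G = proj₁ (listChromatic-exists G)

  χℓ-isLeast : ∀ G → IsLeast (Choosable G) (χℓ G)
  χℓ-isLeast G = proj₂ (listChromatic-exists G)

IsCauchy : (ℕ → ℚ) → Set
IsCauchy x = ∀ ε → 0ℚ ℚ.< ε → ∃ λ N → ∀ m n → N ℕ.≤ m → N ℕ.≤ n → ∣ x m ℚ.- x n ∣ ℚ.≤ ε

-- Cauchy sequences of rationals; two of them denote the same real number when
-- each is _≤ʳ_ the other.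
record ℝ : Set where
  constructor mkℝ
  field
    seq    : ℕ → ℚ
    cauchy : IsCauchy seq

open ℝ

infix 4 _≤ʳ_ _<ʳ_ _≥ʳ_

_≤ʳ_ : Rel ℝ 0ℓ
x ≤ʳ y = ∀ ε → 0ℚ ℚ.< ε → ∃ λ N → ∀ n → N ℕ.≤ n → seq x n ℚ.≤ seq y n ℚ.+ ε

_≥ʳ_ : Rel ℝ 0ℓ
x ≥ʳ y = y ≤ʳ x

_<ʳ_ : Rel ℝ 0ℓ
x <ʳ y = ∃ λ ε → 0ℚ ℚ.< ε × ∃ λ N → ∀ n → N ℕ.≤ n → seq x n ℚ.+ ε ℚ.≤ seq y n

abstract
  const-cauchy : ∀ q → IsCauchy (λ _ → q)
  const-cauchy q ε 0<ε = 0 , λ _ _ _ _ → ℚ.≤-trans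
    (ℚ.≤-reflexive (cong ∣_∣ (ℚ.+-inverseʳ q))) (ℚ.<⇒≤ 0<ε)

fromℚ : ℚ → ℝ
fromℚ q = mkℝ (λ _ → q) (const-cauchy q)

fromℕ : ℕ → ℝ
fromℕ n = fromℚ (+ n / 1)

0ℝ : ℝ
0ℝ = fromℕ 0

module Rearrange where
  open +-*-Solver

  shift : ∀ h r l → l ℚ.+ r ≡ ((h ℚ.+ r) ℚ.+ l) ℚ.- h
  shift = solve 3 (λ h r l → l :+ r := ((h :+ r) :+ l) :- h) refl

  cancelˡ : ∀ h l b → ((h ℚ.+ l) ℚ.+ b) ℚ.- h ≡ l ℚ.+ b
  cancelˡ = solve 3 (λ h l b → ((h :+ l) :+ b) :- h := l :+ b) refl

  cancelʳ : ∀ l r → (l ℚ.+ r) ℚ.- r ≡ l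
  cancelʳ = solve 2 (λ l r → (l :+ r) :- r := l) refl

  cancel : ∀ l r → (l ℚ.+ r) ℚ.- l ≡ r
  cancel = solve 2 (λ l r → (l :+ r) :- l := r) refl

  negate : ∀ a b → a ℚ.- b ≡ ℚ.- (b ℚ.- a)
  negate = solve 2 (λ a b → a :- b := :- (b :- a)) refl

  factor : ∀ k l e r → k ℚ.* (e ℚ.* r) ℚ.+ l ℚ.* (e ℚ.* r) ≡ e ℚ.* ((k ℚ.+ l) ℚ.* r)
  factor = solve 4 (λ k l e r → k :* (e :* r) :+ l :* (e :* r) := e :* ((k :+ l) :* r)) refl

  product : ∀ a b c d → a ℚ.* b ℚ.- c ℚ.* d ≡ a ℚ.* (b ℚ.- d) ℚ.+ d ℚ.* (a ℚ.- c)
  product = solve 4 (λ a b c d → a :* b :- c :* d := a :* (b :- d) :+ d :* (a :- c)) refl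

  insert : ∀ a b → a ≡ (a ℚ.- b) ℚ.+ b
  insert = solve 2 (λ a b → a := (a :- b) :+ b) refl

  suc-* : ∀ a b → a ℚ.* b ℚ.+ b ≡ (1ℚ ℚ.+ a) ℚ.* b
  suc-* = solve 2 (λ a b → a :* b :+ b := (con 1ℚ :+ a) :* b) refl

infixl 7 _*ʳ_

abstract
  bounded : ∀ {x} → IsCauchy x → ∃₂ λ N K → 0ℚ ℚ.< K × (∀ n → N ℕ.≤ n → ∣ x n ∣ ℚ.≤ K)
  bounded {x} c with N , h ← c 1ℚ (ℚ.positive⁻¹ 1ℚ) =
    N , 1ℚ ℚ.+ ∣ x N ∣ ,
    ℚ.<-≤-trans (ℚ.positive⁻¹ 1ℚ)
      (ℚ.≤-trans (ℚ.≤-reflexive (sym (ℚ.+-identityʳ 1ℚ))) (ℚ.+-monoʳ-≤ 1ℚ (ℚ.0≤∣p∣ (x N)))) ,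
    λ n N≤n → begin
      ∣ x n ∣                        ≡⟨ cong ∣_∣ (Rearrange.insert (x n) (x N)) ⟩
      ∣ x n ℚ.- x N ℚ.+ x N ∣        ≤⟨ ℚ.∣p+q∣≤∣p∣+∣q∣ (x n ℚ.- x N) (x N) ⟩
      ∣ x n ℚ.- x N ∣ ℚ.+ ∣ x N ∣    ≤⟨ ℚ.+-monoˡ-≤ ∣ x N ∣ (h n N N≤n ℕ.≤-refl) ⟩
      1ℚ ℚ.+ ∣ x N ∣                 ∎
    where open ℚ.≤-Reasoning

  *-mono : ∀ a b {p q} → 0ℚ ℚ.< p → ∣ a ∣ ℚ.≤ p → ∣ b ∣ ℚ.≤ q → ∣ a ℚ.* b ∣ ℚ.≤ p ℚ.* q
  *-mono a b {p} {q} 0<p a≤p b≤q = begin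
    ∣ a ℚ.* b ∣      ≡⟨ ℚ.∣p*q∣≡∣p∣*∣q∣ a b ⟩
    ∣ a ∣ ℚ.* ∣ b ∣  ≤⟨ ℚ.*-monoʳ-≤-nonNeg ∣ b ∣ {{ℚ.∣-∣-nonNeg b}} a≤p ⟩
    p ℚ.* ∣ b ∣      ≤⟨ ℚ.*-monoˡ-≤-nonNeg p {{ℚ.pos⇒nonNeg p {{ℚ.positive 0<p}}}} b≤q ⟩
    p ℚ.* q          ∎
    where open ℚ.≤-Reasoning

  product-close : ∀ a b c d {K L δ} → 0ℚ ℚ.< K → 0ℚ ℚ.< L → ∣ a ∣ ℚ.≤ K → ∣ d ∣ ℚ.≤ L →
                  ∣ b ℚ.- d ∣ ℚ.≤ δ → ∣ a ℚ.- c ∣ ℚ.≤ δ →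
                  ∣ a ℚ.* b ℚ.- c ℚ.* d ∣ ℚ.≤ K ℚ.* δ ℚ.+ L ℚ.* δ
  product-close a b c d {K} {L} {δ} 0<K 0<L a≤K d≤L b-d≤δ a-c≤δ = begin
    ∣ a ℚ.* b ℚ.- c ℚ.* d ∣
      ≡⟨ cong ∣_∣ (Rearrange.product a b c d) ⟩
    ∣ a ℚ.* (b ℚ.- d) ℚ.+ d ℚ.* (a ℚ.- c) ∣
      ≤⟨ ℚ.∣p+q∣≤∣p∣+∣q∣ (a ℚ.* (b ℚ.- d)) (d ℚ.* (a ℚ.- c)) ⟩
    ∣ a ℚ.* (b ℚ.- d) ∣ ℚ.+ ∣ d ℚ.* (a ℚ.- c) ∣
      ≤⟨ ℚ.+-mono-≤ (*-mono a (b ℚ.- d) 0<K a≤K b-d≤δ) (*-mono d (a ℚ.- c) 0<L d≤L a-c≤δ) ⟩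
    K ℚ.* δ ℚ.+ L ℚ.* δ ∎
    where open ℚ.≤-Reasoning

  divide : ∀ K L ε → 0ℚ ℚ.< K → 0ℚ ℚ.< L → 0ℚ ℚ.< ε →
           ∃ λ δ → 0ℚ ℚ.< δ × K ℚ.* δ ℚ.+ L ℚ.* δ ≡ ε
  divide K L ε 0<K 0<L 0<ε =
    ε ℚ.* r ,
    ℚ.positive⁻¹ (ε ℚ.* r) {{ℚ.pos*pos⇒pos ε {{ℚ.positive 0<ε}} r {{ℚ.1/pos⇒pos (K ℚ.+ L) {{S>0}}}}}} ,
    trans (Rearrange.factor K L ε r)
      (trans (cong (ε ℚ.*_) (ℚ.*-inverseʳ (K ℚ.+ L) {{S≢0}})) (ℚ.*-identityʳ ε))
    where
    S>0 : ℚ.Positive (K ℚ.+ L)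
    S>0 = ℚ.pos+pos⇒pos K {{ℚ.positive 0<K}} L {{ℚ.positive 0<L}}

    S≢0 : ℚ.NonZero (K ℚ.+ L)
    S≢0 = ℚ.pos⇒nonZero (K ℚ.+ L) {{S>0}}

    r : ℚ
    r = ℚ.1/_ (K ℚ.+ L) {{S≢0}}

  *-cauchy : ∀ {x y} → IsCauchy x → IsCauchy y → IsCauchy (λ n → x n ℚ.* y n)
  *-cauchy {x} {y} cx cy ε 0<ε =
    let Nx , K , 0<K , x≤K = bounded {x} cx
        Ny , L , 0<L , y≤L = bounded {y} cy
        δ , 0<δ , Kδ+Lδ≡ε  = divide K L ε 0<K 0<L 0<ε
        Mx , hx            = cx δ 0<δ
        My , hy            = cy δ 0<δ
        N                  = (Nx ℕ.⊔ Ny) ℕ.⊔ (Mx ℕ.⊔ My)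
        Nx≤N = ℕ.≤-trans (ℕ.m≤m⊔n Nx Ny) (ℕ.m≤m⊔n (Nx ℕ.⊔ Ny) (Mx ℕ.⊔ My))
        Ny≤N = ℕ.≤-trans (ℕ.m≤n⊔m Nx Ny) (ℕ.m≤m⊔n (Nx ℕ.⊔ Ny) (Mx ℕ.⊔ My))
        Mx≤N = ℕ.≤-trans (ℕ.m≤m⊔n Mx My) (ℕ.m≤n⊔m (Nx ℕ.⊔ Ny) (Mx ℕ.⊔ My))
        My≤N = ℕ.≤-trans (ℕ.m≤n⊔m Mx My) (ℕ.m≤n⊔m (Nx ℕ.⊔ Ny) (Mx ℕ.⊔ My))
    in N , λ m n N≤m N≤n → ℚ.≤-trans
      (product-close (x m) (y m) (x n) (y n) 0<K 0<L
        (x≤K m (ℕ.≤-trans Nx≤N N≤m)) (y≤L n (ℕ.≤-trans Ny≤N N≤n))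
        (hy m n (ℕ.≤-trans My≤N N≤m) (ℕ.≤-trans My≤N N≤n))
        (hx m n (ℕ.≤-trans Mx≤N N≤m) (ℕ.≤-trans Mx≤N N≤n)))
      (ℚ.≤-reflexive Kδ+Lδ≡ε)

_*ʳ_ : ℝ → ℝ → ℝ
x *ʳ y = mkℝ (λ n → seq x n ℚ.* seq y n) (*-cauchy {seq x} {seq y} (cauchy x) (cauchy y))

sum : ℕ → (ℕ → ℚ) → ℚ
sum zero    f = 0ℚ
sum (suc n) f = sum n f ℚ.+ f n

recip : ℕ → ℚ
recip n = + 1 / suc n

-- With M = m + 1, the lower Riemann sum of log n = ∫₁ⁿ dt/t over subintervals
-- of length 1/M:  Σ_{1 ≤ i ≤ (n-1)M} (1/M) · 1/(1 + i/M) = Σ_{1 ≤ i ≤ (n-1)M} 1/(M + i).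
logSum : ℕ → ℕ → ℚ
logSum n m = sum ((n ℕ.∸ 1) ℕ.* suc m) λ i → recip (suc m ℕ.+ i)

sum-+ : ∀ a b f → sum (a ℕ.+ b) f ≡ sum a f ℚ.+ sum b (λ i → f (a ℕ.+ i))
sum-+ a zero f rewrite ℕ.+-identityʳ a = sym (ℚ.+-identityʳ _)
sum-+ a (suc b) f rewrite ℕ.+-suc a b =
  trans (cong (ℚ._+ f (a ℕ.+ b)) (sum-+ a b f)) (ℚ.+-assoc (sum a f) _ _)

sum-mono : ∀ n {f g} → (∀ i → i ℕ.< n → f i ℚ.≤ g i) → sum n f ℚ.≤ sum n g
sum-mono zero    h = ℚ.≤-refl
sum-mono (suc n) h = ℚ.+-mono-≤ (sum-mono n λ i i<n → h i (ℕ.m<n⇒m<1+n i<n)) (h n ℕ.≤-refl)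

recip-anti : ∀ {a b} → a ℕ.≤ b → recip b ℚ.≤ recip a
recip-anti {a} {b} a≤b = ℚ.toℚᵘ-cancel-≤ (begin
  ℚ.toℚᵘ (recip b)   ≃⟨ ℚ.toℚᵘ-fromℚᵘ (ℚᵘ.mkℚᵘ (+ 1) b) ⟩
  ℚᵘ.mkℚᵘ (+ 1) b    ≤⟨ ℚᵘ.*≤* (ℤ.*-monoˡ-≤-nonNeg (+ 1) (ℤ.+≤+ (ℕ.s≤s a≤b))) ⟩
  ℚᵘ.mkℚᵘ (+ 1) a    ≃⟨ ℚ.toℚᵘ-fromℚᵘ (ℚᵘ.mkℚᵘ (+ 1) a) ⟨
  ℚ.toℚᵘ (recip a)   ∎)
  where open ℚᵘ.≤-Reasoning

recip-small : ∀ ε → 0ℚ ℚ.< ε → ∃ λ N → recip N ℚ.≤ ε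
recip-small ε 0<ε with ℚ.positive 0<ε
recip-small (ℚ.mkℚ (+ suc p) d c) _ | _ = d , ℚ.toℚᵘ-cancel-≤ (begin
  ℚ.toℚᵘ (recip d)       ≃⟨ ℚ.toℚᵘ-fromℚᵘ (ℚᵘ.mkℚᵘ (+ 1) d) ⟩
  ℚᵘ.mkℚᵘ (+ 1) d        ≤⟨ ℚᵘ.*≤* (ℤ.*-monoʳ-≤-nonNeg (+ suc d) (ℤ.+≤+ (ℕ.s≤s (ℕ.z≤n {p})))) ⟩
  ℚᵘ.mkℚᵘ (+ suc p) d    ∎)
  where open ℚᵘ.≤-Reasoning

sum-const : ∀ n q → sum n (λ _ → q) ≡ (+ n / 1) ℚ.* q
sum-const zero    q = sym (ℚ.*-zeroˡ q)
sum-const (suc n) q = begin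
  sum n (λ _ → q) ℚ.+ q      ≡⟨ cong (ℚ._+ q) (sum-const n q) ⟩
  (+ n / 1) ℚ.* q ℚ.+ q      ≡⟨ Rearrange.suc-* (+ n / 1) q ⟩
  (1ℚ ℚ.+ + n / 1) ℚ.* q     ≡⟨ cong (ℚ._* q) (ℚ.toℚᵘ-injective eq) ⟩
  (+ suc n / 1) ℚ.* q        ∎
  where
  open ≡-Reasoning
  eq : ℚ.toℚᵘ (1ℚ ℚ.+ + n / 1) ℚᵘ.≃ ℚ.toℚᵘ (+ suc n / 1)
  eq = ℚᵘ.≃-trans (ℚ.toℚᵘ-homo-+ 1ℚ (+ n / 1))
      (ℚᵘ.≃-trans (ℚᵘ.+-congʳ ℚᵘ.1ℚᵘ (ℚ.toℚᵘ-fromℚᵘ (ℚᵘ.mkℚᵘ (+ n) 0)))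
      (ℚᵘ.≃-trans (ℚᵘ.*≡* (cong (ℤ._* + 1) (cong (λ z → (+ 1) ℤ.+ z) (ℤ.*-identityʳ (+ n)))))
      (ℚᵘ.≃-sym (ℚ.toℚᵘ-fromℚᵘ (ℚᵘ.mkℚᵘ (+ suc n) 0)))))

*-recip : ∀ n a → (+ suc n / 1) ℚ.* recip (a ℕ.+ n ℕ.* suc a) ≡ recip a
*-recip n a = ℚ.toℚᵘ-injective
  (ℚᵘ.≃-trans (ℚ.toℚᵘ-homo-* (+ suc n / 1) (recip b))
  (ℚᵘ.≃-trans (ℚᵘ.*-cong (ℚ.toℚᵘ-fromℚᵘ (ℚᵘ.mkℚᵘ (+ suc n) 0)) (ℚ.toℚᵘ-fromℚᵘ (ℚᵘ.mkℚᵘ (+ 1) b)))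
  (ℚᵘ.≃-trans (ℚᵘ.*≡* (cong +_ eq))
  (ℚᵘ.≃-sym (ℚ.toℚᵘ-fromℚᵘ (ℚᵘ.mkℚᵘ (+ 1) a))))))
  where
  b = a ℕ.+ n ℕ.* suc a
  eq : (suc n ℕ.* 1) ℕ.* suc a ≡ 1 ℕ.* (1 ℕ.* suc b)
  eq = trans (cong (ℕ._* suc a) (ℕ.*-identityʳ (suc n)))
             (sym (trans (ℕ.*-identityˡ _) (ℕ.*-identityˡ _)))

-- logSum n m increases with m and logSum n m + recip m decreases, so logSum n
-- is Cauchy: its tail from m on varies by at most recip m.
module _ (n′ : ℕ) where

  private
    n : ℕ
    n = suc n′

    H : ℕ → ℚ
    H k = sum k recip

    block : ℕ → ℚ
    block m = sum n (λ i → recip (n ℕ.* suc m ℕ.+ i))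

    H-split : ∀ m → H (n ℕ.* suc m) ≡ H (suc m) ℚ.+ logSum n m
    H-split m = sum-+ (suc m) (n′ ℕ.* suc m) recip

    H-step : ∀ m → H (n ℕ.* suc (suc m)) ≡ H (n ℕ.* suc m) ℚ.+ block m
    H-step m = trans
      (cong H (trans (ℕ.*-suc n (suc m)) (ℕ.+-comm n (n ℕ.* suc m))))
      (sum-+ (n ℕ.* suc m) n recip)

    logSum-step : ∀ m → logSum n (suc m) ℚ.+ recip (suc m) ≡ logSum n m ℚ.+ block m
    logSum-step m = begin
      logSum n (suc m) ℚ.+ recip (suc m)
        ≡⟨ Rearrange.shift (H (suc m)) (recip (suc m)) (logSum n (suc m)) ⟩
      H (suc (suc m)) ℚ.+ logSum n (suc m) ℚ.- H (suc m)
        ≡⟨ cong (ℚ._- H (suc m)) (trans (sym (H-split (suc m))) (trans (H-step m) (cong (ℚ._+ block m) (H-split m)))) ⟩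
      H (suc m) ℚ.+ logSum n m ℚ.+ block m ℚ.- H (suc m)
        ≡⟨ Rearrange.cancelˡ (H (suc m)) (logSum n m) (block m) ⟩
      logSum n m ℚ.+ block m ∎
      where open ≡-Reasoning

    block-lower : ∀ m → recip (suc m) ℚ.≤ block m
    block-lower m = begin
      recip (suc m)
        ≡⟨ trans (sum-const n _) (*-recip n′ (suc m)) ⟨
      sum n (λ _ → recip (suc m ℕ.+ n′ ℕ.* suc (suc m)))
        ≤⟨ sum-mono n (λ i i<n → recip-anti (bound i i<n)) ⟩
      block m ∎
      where
      open ℚ.≤-Reasoning
      bound : ∀ i → i ℕ.< n → n ℕ.* suc m ℕ.+ i ℕ.≤ suc m ℕ.+ n′ ℕ.* suc (suc m)
      bound i i<n = ℕ.s≤s⁻¹ (ℕ.≤-trans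
        (ℕ.≤-reflexive (sym (ℕ.+-suc (n ℕ.* suc m) i)))
        (ℕ.≤-trans (ℕ.+-monoʳ-≤ (n ℕ.* suc m) i<n)
        (ℕ.≤-reflexive (trans (ℕ.+-comm (n ℕ.* suc m) n) (sym (ℕ.*-suc n (suc m)))))))

    block-upper : ∀ m → block m ℚ.≤ recip m
    block-upper m = begin
      block m
        ≤⟨ sum-mono n (λ i _ → recip-anti (ℕ.≤-trans (ℕ.n≤1+n _) (ℕ.m≤m+n (n ℕ.* suc m) i))) ⟩
      sum n (λ _ → recip (m ℕ.+ n′ ℕ.* suc m))
        ≡⟨ trans (sum-const n _) (*-recip n′ m) ⟩
      recip m ∎
      where open ℚ.≤-Reasoning

    increasing : ∀ m → logSum n m ℚ.≤ logSum n (suc m)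
    increasing m = begin
      logSum n m
        ≡⟨ Rearrange.cancelʳ (logSum n m) (recip (suc m)) ⟨
      logSum n m ℚ.+ recip (suc m) ℚ.- recip (suc m)
        ≤⟨ ℚ.+-monoˡ-≤ (ℚ.- recip (suc m)) (ℚ.+-monoʳ-≤ (logSum n m) (block-lower m)) ⟩
      logSum n m ℚ.+ block m ℚ.- recip (suc m)
        ≡⟨ cong (ℚ._- recip (suc m)) (logSum-step m) ⟨
      logSum n (suc m) ℚ.+ recip (suc m) ℚ.- recip (suc m)
        ≡⟨ Rearrange.cancelʳ (logSum n (suc m)) (recip (suc m)) ⟩
      logSum n (suc m) ∎
      where open ℚ.≤-Reasoning

    decreasing : ∀ m → logSum n (suc m) ℚ.+ recip (suc m) ℚ.≤ logSum n m ℚ.+ recip m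
    decreasing m = ℚ.≤-trans (ℚ.≤-reflexive (logSum-step m))
                             (ℚ.+-monoʳ-≤ (logSum n m) (block-upper m))

    monotone : (f : ℕ → ℚ) (_≲_ : Rel ℚ 0ℓ) → (∀ {a} → a ≲ a) →
               (∀ {a b c} → a ≲ b → b ≲ c → a ≲ c) → (∀ m → f m ≲ f (suc m)) →
               ∀ {m p} → m ℕ.≤′ p → f m ≲ f p
    monotone f _≲_ r t s ℕ.≤′-refl       = r
    monotone f _≲_ r t s (ℕ.≤′-step m≤p) = t (monotone f _≲_ r t s m≤p) (s _)

  logSum-increasing : ∀ {m p} → m ℕ.≤ p → logSum n m ℚ.≤ logSum n p
  logSum-increasing m≤p = monotone (logSum n) ℚ._≤_ ℚ.≤-refl ℚ.≤-trans increasing (ℕ.≤⇒≤′ m≤p)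

  logSum-upper : ∀ {m p} → m ℕ.≤ p → logSum n p ℚ.≤ logSum n m ℚ.+ recip m
  logSum-upper {m} {p} m≤p = begin
    logSum n p
      ≡⟨ ℚ.+-identityʳ (logSum n p) ⟨
    logSum n p ℚ.+ 0ℚ
      ≤⟨ ℚ.+-monoʳ-≤ (logSum n p) (ℚ.<⇒≤ (ℚ.positive⁻¹ (recip p) {{ℚ.normalize-pos 1 (suc p)}})) ⟩
    logSum n p ℚ.+ recip p
      ≤⟨ monotone (λ k → logSum n k ℚ.+ recip k) ℚ._≥_ ℚ.≤-refl (λ b≤a c≤b → ℚ.≤-trans c≤b b≤a)
                  decreasing (ℕ.≤⇒≤′ m≤p) ⟩
    logSum n m ℚ.+ recip m ∎
    where open ℚ.≤-Reasoning

abstract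
  logSum-cauchy : ∀ n → IsCauchy (logSum n)
  logSum-cauchy zero = const-cauchy 0ℚ
  logSum-cauchy (suc n′) ε 0<ε with N , small ← recip-small ε 0<ε = N , close
    where
    L : ℕ → ℚ
    L = logSum (suc n′)

    ordered : ∀ {m p} → N ℕ.≤ m → m ℕ.≤ p → ∣ L p ℚ.- L m ∣ ℚ.≤ ε
    ordered {m} {p} N≤m m≤p = begin
      ∣ L p ℚ.- L m ∣
        ≡⟨ ℚ.0≤p⇒∣p∣≡p (ℚ.≤-trans (ℚ.≤-reflexive (sym (ℚ.+-inverseʳ (L m))))
                                  (ℚ.+-monoˡ-≤ (ℚ.- L m) (logSum-increasing n′ m≤p))) ⟩
      L p ℚ.- L m
        ≤⟨ ℚ.+-monoˡ-≤ (ℚ.- L m) (logSum-upper n′ m≤p) ⟩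
      L m ℚ.+ recip m ℚ.- L m
        ≡⟨ Rearrange.cancel (L m) (recip m) ⟩
      recip m
        ≤⟨ recip-anti N≤m ⟩
      recip N
        ≤⟨ small ⟩
      ε ∎
      where open ℚ.≤-Reasoning

    close : ∀ m p → N ℕ.≤ m → N ℕ.≤ p → ∣ L m ℚ.- L p ∣ ℚ.≤ ε
    close m p N≤m N≤p with ℕ.≤-total m p
    ... | inj₂ p≤m = ordered N≤p p≤m
    ... | inj₁ m≤p = ℚ.≤-trans (ℚ.≤-reflexive flip) (ordered N≤m m≤p)
      where
      flip : ∣ L m ℚ.- L p ∣ ≡ ∣ L p ℚ.- L m ∣
      flip = trans (cong ∣_∣ (Rearrange.negate (L m) (L p)))
                   (ℚ.∣-p∣≡∣p∣ (L p ℚ.- L m))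

-- log 0 is 0 by convention.
log : ℕ → ℝ
log n = mkℝ (logSum n) (logSum-cauchy n)

{-# OPTIONS --safe #-}

-- Let r = 2 ^ n and m = 4 ^ h. The graph has leaves (i , a) with i < r, a < m, and, for each bit
-- position s and all a, b, a path of length k from the leaves (i , a) with iₛ = 0 to the leaves
-- (j , b) with jₛ = 1. Leaves with i ≠ j differ in some bit, so they are at distance at most k.
-- Changing a requires a full path, which flips a bit, so leaves (i , a) and (i , b) with a ≠ b are
-- further apart. Hence the leaves induce the complete r-partite graph with parts of size m in the
-- kth power. There are only n m² (k - 1) inner path vertices, and for n = 6h and h large these are
-- at most r, so r ≤ χ ≤ 2r. For the list chromatic number, divide a palette of h r colors into 2h
-- blocks and let the lists within a part avoid every possible set of h blocks. Each part must then
-- use colors from at least h + 1 blocks, which altogether needs more than h r colors; so χℓ exceeds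
-- the list size h r / 2, of order r log r.

module Submission where

open import Defs
open import Level using (0ℓ) renaming (suc to lsuc)
open import Data.Nat using (ℕ; _≤_)
open import Data.Product using (∃; ∃-syntax; _×_)
open import Relation.Unary using (Pred)
open import Relation.Binary.PropositionalEquality using (_≡_)

open import Data.Nat using (zero; suc; _+_; _*_; _∸_; _^_; _<_; z≤n; s≤s; s≤s⁻¹; _<?_)
import Data.Nat.Properties as ℕ
open import Data.Nat.Solver using (module +-*-Solver)
open import Data.Fin using (Fin; zero; suc; toℕ; fromℕ<; inject₁; inject≤; combine; remQuot; finToFun; funToFin)
import Data.Fin.Properties as Fin
open import Data.Integer using (+_)
import Data.Integer as ℤ
import Data.Integer.Properties as ℤ
open import Data.Rational as ℚ using (ℚ; 0ℚ; 1ℚ; _/_)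
import Data.Rational.Properties as ℚ
import Data.Rational.Unnormalised as ℚᵘ
import Data.Rational.Unnormalised.Properties as ℚᵘ
open import Data.List using (map)
open import Data.List.Extrema.Nat using (max; xs≤max)
open import Data.List.Relation.Unary.All as All using ()
open import Data.List.Relation.Unary.All.Properties using (map⁻)
open import Data.Vec using (tabulate)
open import Data.Vec.Properties using (lookup∘tabulate)
open import Data.Vec.Relation.Unary.Unique.Propositional.Properties using (tabulate⁺)
open import Data.Product using (_,_; proj₁; proj₂; uncurry)
open import Data.Product.Function.NonDependent.Propositional using (_×-↔_)
open import Data.Sum as Sum using (_⊎_; inj₁; inj₂)
open import Data.Sum.Properties using (inj₁-injective; inj₂-injective)
open import Data.Sum.Function.Propositional using (_⊎-↔_)
open import Function using (_∘_; _↔_; Inverse; Injection; Injective; module Bijection)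
open import Function.Properties.Inverse using (↔-trans; ↔-refl; ↔-sym; ↔⇒↣)
open import Relation.Nullary using (¬_; Dec; yes; no; contradiction)
open import Relation.Nullary.Decidable using (_×-dec_; _⊎-dec_)
open import Relation.Binary.PropositionalEquality
  using (_≢_; _≗_; refl; sym; trans; cong; cong₂; subst; subst₂)

-- Subsets of prescribed size.

Embeds : ∀ {N} → ℕ → Pred (Fin N) 0ℓ → Set
Embeds {N} a P = ∃ λ (f : Fin a → Fin N) → Injective _≡_ _≡_ f × (∀ i → P (f i))

module _ {N : ℕ} {P : Pred (Fin (suc N)) 0ℓ} where

  embeds-suc : ∀ {a} → Embeds a (P ∘ suc) → Embeds a P
  embeds-suc (f , inj , p) = suc ∘ f , inj ∘ Fin.suc-injective , p

  embeds-cons : ∀ {a} → P zero → Embeds a (P ∘ suc) → Embeds (suc a) P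
  embeds-cons {a} p₀ (f , inj , p) = g , g-inj , λ { zero → p₀ ; (suc i) → p i }
    where
    g : Fin (suc a) → Fin (suc N)
    g zero    = zero
    g (suc i) = suc (f i)

    g-inj : Injective _≡_ _≡_ g
    g-inj {zero}  {zero}  _  = refl
    g-inj {suc _} {suc _} eq = cong suc (inj (Fin.suc-injective eq))

embeds-zero : ∀ {N} (P : Pred (Fin N) 0ℓ) → Embeds 0 P
embeds-zero P = (λ ()) , (λ { {()} }) , λ ()

-- If fewer than `a` elements satisfy `P`, at least `N + 1 - a` do not. The application has
-- `a = h + 1`, `b = h`, `N = 2h`, where the hypothesis is tight.
dichotomy : ∀ {N} a b {P : Pred (Fin N) 0ℓ} → (∀ x → Dec (P x)) → a + b ≤ suc N →
            Embeds a P ⊎ Embeds b (¬_ ∘ P)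
dichotomy zero b {P} P? _ = inj₁ (embeds-zero P)
dichotomy (suc a) zero {P} P? _ = inj₂ (embeds-zero (¬_ ∘ P))
dichotomy {zero} (suc a) (suc b) P? h =
  contradiction (subst (_≤ 0) (ℕ.+-suc a b) (s≤s⁻¹ h)) λ ()
dichotomy {suc N} (suc a) (suc b) {P} P? h with P? zero
... | yes p = Sum.map (embeds-cons {P = P} p) (embeds-suc {P = ¬_ ∘ P})
  (dichotomy a (suc b) (P? ∘ suc) (s≤s⁻¹ h))
... | no ¬p = Sum.map (embeds-suc {P = P}) (embeds-cons {P = ¬_ ∘ P} ¬p)
  (dichotomy (suc a) b (P? ∘ suc) (s≤s⁻¹ (subst (_≤ suc (suc N)) (cong suc (ℕ.+-suc a b)) h)))

-- Lists from blocks of colors and the list-coloring lower bound.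

-- The palette consists of 2h blocks of q colors. A slot encodes a set of blocks, and its list
-- consists of h blocks that avoid this set if it has at most h elements (otherwise of any h).
module BlockLists (q h : ℕ) where

  Slot : Set
  Slot = Fin (2 ^ (h + h))

  _∋_ : Slot → Fin (h + h) → Set
  a ∋ x = finToFun {2} {h + h} a x ≡ suc zero

  blocks : ∀ a → ∃ λ (f : Fin h → Fin (h + h)) →
           Injective _≡_ _≡_ f × (Embeds (suc h) (a ∋_) ⊎ (∀ y → ¬ (a ∋ f y)))
  blocks a with dichotomy (suc h) h (λ x → finToFun {2} {h + h} a x Fin.≟ suc zero) ℕ.≤-refl
  -- Dropping one of the `h + 1` elements leaves `h` blocks for a list; the full embedding is kept
  -- as evidence for `many-used`.
  ... | inj₁ e@(f , inj , _)    = f ∘ inject₁ , Fin.inject₁-injective ∘ inj , inj₁ e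
  ... | inj₂ (f , inj , avoids) = f , inj , inj₂ avoids

  block : Slot → Fin h → Fin (h + h)
  block a = proj₁ (blocks a)

  color : Slot → Fin (h * q) → Fin ((h + h) * q)
  color a e = let y , j = remQuot {h} q e in combine (block a y) j

  color-injective : ∀ a → Injective _≡_ _≡_ (color a)
  color-injective a {e} {e′} eq
    with y≡ , j≡ ← Fin.combine-injective (block a (proj₁ (remQuot {h} q e))) _
                                         (block a (proj₁ (remQuot {h} q e′))) _ eq =
    trans (sym (Fin.combine-remQuot {h} q e))
      (trans (cong₂ combine (proj₁ (proj₂ (blocks a)) y≡) j≡) (Fin.combine-remQuot {h} q e′))

  blockOf : Fin ((h + h) * q) → Fin (h + h)
  blockOf c = proj₁ (remQuot {h + h} q c)

  blockOf-color : ∀ a e → blockOf (color a e) ≡ block a (proj₁ (remQuot {h} q e))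
  blockOf-color a e = cong proj₁ (Fin.remQuot-combine {h + h} (block a (proj₁ (remQuot {h} q e))) _)

  -- `H` contains a complete `r`-partite graph whose parts are indexed by the slots. `slot` is total
  -- because vertices other than leaves need lists too.
  module _ (H : Graph) (r : ℕ) (leaf : Fin r → Slot → Graph.Vertex H)
           (slot : Graph.Vertex H → Slot) (slot-leaf : ∀ i a → slot (leaf i a) ≡ a)
           (adjacent : ∀ {i i′} → i ≢ i′ → ∀ a a′ → Graph._~_ H (leaf i a) (leaf i′ a′)) where

    chromatic-lower : ∀ {t} → Slot → Colorable H t → r ≤ t
    chromatic-lower a (f , proper) = Fin.injective⇒≤ {f = λ i → f (leaf i a)} inj
      where
      inj : Injective _≡_ _≡_ (λ i → f (leaf i a))
      inj {i} {j} eq with i Fin.≟ j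
      ... | yes i≡j = i≡j
      ... | no  i≢j = contradiction eq (proper _ _ (adjacent i≢j a a))

    module _ {t : ℕ} (t≤hq : t ≤ h * q) where

      entry : Slot → Fin t → Fin ((h + h) * q)
      entry a e = color a (inject≤ e t≤hq)

      entry-injective : ∀ a → Injective _≡_ _≡_ (entry a)
      entry-injective a eq = Fin.inject≤-injective t≤hq t≤hq _ _ (color-injective a eq)

      lists : ListAssignment H t
      lists = (λ v → tabulate (toℕ ∘ entry (slot v))) ,
              (λ v → tabulate⁺ (entry-injective (slot v) ∘ Fin.toℕ-injective))

      module _ (colorable : ListColorable H (proj₁ lists)) where

        -- Working with list positions keeps the colors in the finite palette, where `blockOf` is
        -- defined.
        index : Graph.Vertex H → Fin t
        index = proj₁ (ListColorable⇒choice H (proj₁ lists) colorable)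

        f : Graph.Vertex H → Fin ((h + h) * q)
        f v = entry (slot v) (index v)

        f-proper : ∀ u v → Graph._~_ H u v → f u ≢ f v
        f-proper u v e =
          IsProper-resp H {g = toℕ ∘ f} (λ v → lookup∘tabulate _ (index v))
            (proj₂ (ListColorable⇒choice H (proj₁ lists) colorable)) u v e
          ∘ cong toℕ

        Used : Fin r → Pred (Fin (h + h)) 0ℓ
        Used i x = ∃ λ a → blockOf (f (leaf i a)) ≡ x

        used? : ∀ i x → Dec (Used i x)
        used? i x = Fin.any? λ a → blockOf (f (leaf i a)) Fin.≟ x

        indicator : ∀ {A : Set} → Dec A → Fin 2
        indicator (yes _) = suc zero
        indicator (no  _) = zero

        usedSlot : Fin r → Slot
        usedSlot i = funToFin (indicator ∘ used? i)

        ∋⇒used : ∀ i x → usedSlot i ∋ x → Used i x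
        ∋⇒used i x e with used? i x | trans (sym (Fin.finToFun-funToFin (indicator ∘ used? i) x)) e
        ... | yes u | _ = u

        used⇒∋ : ∀ i x → Used i x → usedSlot i ∋ x
        used⇒∋ i x u = trans (Fin.finToFun-funToFin (indicator ∘ used? i) x) eq
          where
          eq : indicator (used? i x) ≡ suc zero
          eq with used? i x
          ... | yes _ = refl
          ... | no ¬u = contradiction u ¬u

        -- A diagonal argument: consider the leaf of part `i` whose slot encodes the set of blocks
        -- used on part `i`. If its list avoided that set, the block of its color would be both used
        -- and avoided.
        many-used : ∀ i → Embeds (suc h) (Used i)
        many-used i with blocks (usedSlot i) in eq
        ... | _ , _ , inj₁ (g , inj , p) = g , inj , λ y → ∋⇒used i (g y) (p y)
        ... | g , _ , inj₂ avoids =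
          contradiction (used⇒∋ i _ (usedSlot i , from-list)) (avoids y)
          where
          v = leaf i (usedSlot i)
          y = proj₁ (remQuot {h} q (inject≤ (index v) t≤hq))
          from-list : blockOf (f v) ≡ g y
          from-list = trans (blockOf-color (slot v) _)
            (trans (cong (λ a → block a y) (slot-leaf i (usedSlot i))) (cong (λ b → proj₁ b y) eq))

        witness : Fin r → Fin (suc h) → Fin ((h + h) * q)
        witness i y = f (leaf i (proj₁ (proj₂ (proj₂ (many-used i)) y)))

        blockOf-witness : ∀ i y → blockOf (witness i y) ≡ proj₁ (many-used i) y
        blockOf-witness i y = proj₂ (proj₂ (proj₂ (many-used i)) y)

        -- Different parts are completely joined, so they share no color; within a part the
        -- witnesses lie in different blocks.
        witness-injective : ∀ {i j y z} → Dec (i ≡ j) → witness i y ≡ witness j z → i ≡ j × y ≡ z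
        witness-injective (no i≢j) eq = contradiction eq (f-proper _ _ (adjacent i≢j _ _))
        witness-injective {i} {_} {y} {z} (yes refl) eq = refl , proj₁ (proj₂ (many-used i))
          (trans (sym (blockOf-witness i y)) (trans (cong blockOf eq) (blockOf-witness i z)))

        witnesses-fit : r * suc h ≤ (h + h) * q
        witnesses-fit = Fin.injective⇒≤ {f = uncurry witness ∘ remQuot {r} (suc h)} λ {e} {e′} eq →
          let i≡j , y≡z = witness-injective (_ Fin.≟ _) eq in
          trans (sym (Fin.combine-remQuot {r} (suc h) e))
            (trans (cong₂ combine i≡j y≡z) (Fin.combine-remQuot {r} (suc h) e′))

      not-choosable : (h + h) * q < r * suc h → ¬ Choosable H t
      not-choosable small choosable =
        contradiction (witnesses-fit (choosable lists)) (ℕ.<⇒≱ small)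

-- The path graph and distances between its leaves.

module PathGraph (n m κ : ℕ) where

  k : ℕ
  k = suc κ

  Link : Set
  Link = Fin n × ((Fin m × Fin m) × Fin κ)

  Node : Set
  Node = (Fin (2 ^ n) × Fin m) ⊎ Link

  #links : ℕ
  #links = n * (m * m * κ)

  link↔ : Fin #links ↔ Link
  link↔ = ↔-trans Fin.*↔× (↔-refl ×-↔ ↔-trans Fin.*↔× (Fin.*↔× ×-↔ ↔-refl))

  node↔ : Fin (2 ^ n * m + #links) ↔ Node
  node↔ = ↔-trans Fin.+↔⊎ (Fin.*↔× ⊎-↔ link↔)

  bit : Fin (2 ^ n) → Fin n → Fin 2
  bit = finToFun

  -- For all s, a, b a path of length k runs from every leaf (i , a) with bit i s = 0
  -- to every leaf (j , b) with bit j s = 1; At v s a b p places v at distance p from its start.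
  At : Node → Fin n → Fin m → Fin m → ℕ → Set
  At (inj₁ (i , c)) s a b p = (p ≡ 0 × bit i s ≡ zero × c ≡ a)
                            ⊎ (p ≡ k × bit i s ≡ suc zero × c ≡ b)
  At (inj₂ (s′ , (a′ , b′) , t)) s a b p = s′ ≡ s × a′ ≡ a × b′ ≡ b × p ≡ suc (toℕ t)

  at? : ∀ v s a b p → Dec (At v s a b p)
  at? (inj₁ (i , c)) s a b p =
    (p ℕ.≟ 0 ×-dec bit i s Fin.≟ zero ×-dec c Fin.≟ a) ⊎-dec
    (p ℕ.≟ k ×-dec bit i s Fin.≟ suc zero ×-dec c Fin.≟ b)
  at? (inj₂ (s′ , (a′ , b′) , t)) s a b p =
    s′ Fin.≟ s ×-dec a′ Fin.≟ a ×-dec b′ Fin.≟ b ×-dec p ℕ.≟ suc (toℕ t)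

  Step : Node → Node → Set
  Step u v = ∃ λ s → ∃ λ a → ∃ λ b → ∃ λ (t : Fin k) →
             At u s a b (toℕ t) × At v s a b (suc (toℕ t))

  step? : ∀ u v → Dec (Step u v)
  step? u v = Fin.any? λ s → Fin.any? λ a → Fin.any? λ b → Fin.any? λ t →
              at? u s a b (toℕ t) ×-dec at? v s a b (suc (toℕ t))

  step-irrefl : ∀ v → ¬ Step v v
  -- This case arises only for `k = 1`; the two ends require opposite values of the bit.
  step-irrefl (inj₁ _) (_ , _ , _ , _ , inj₁ (_ , b₀ , _) , inj₂ (_ , b₁ , _))
    with () ← trans (sym b₀) b₁
  step-irrefl (inj₁ _) (_ , _ , _ , _ , inj₂ (t≡k , _) , inj₂ (1+t≡k , _)) =
    ℕ.1+n≢n (trans 1+t≡k (sym t≡k))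
  step-irrefl (inj₂ _) (_ , _ , _ , _ , (_ , _ , _ , eq) , (_ , _ , _ , eq′)) =
    ℕ.1+n≢n (trans eq′ (sym eq))

  Edge : Node → Node → Set
  Edge u v = Step u v ⊎ Step v u

  open Inverse node↔ using (to; from; strictlyInverseˡ)

  to-injective : Injective _≡_ _≡_ to
  to-injective = Injection.injective (↔⇒↣ node↔)

  graph : Graph
  graph = record
    { order    = 2 ^ n * m + #links
    ; _~_      = λ u v → Edge (to u) (to v)
    ; ~-irrefl = λ { refl → Sum.[ step-irrefl _ , step-irrefl _ ] }
    ; ~-sym    = Sum.swap
    ; _~?_     = λ u v → step? (to u) (to v) ⊎-dec step? (to v) (to u)
    }

  open Graph graph using (Vertex; _~_)

  leaf : Fin (2 ^ n) → Fin m → Vertex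
  leaf i a = from (inj₁ (i , a))

  -- `d` is the value at inner path vertices, where any slot will do.
  slot : Fin m → Vertex → Fin m
  slot d v = Sum.[ proj₂ , (λ _ → d) ] (to v)

  slot-leaf : ∀ d i a → slot d (leaf i a) ≡ a
  slot-leaf d i a = cong Sum.[ proj₂ , (λ _ → d) ] (strictlyInverseˡ (inj₁ (i , a)))

  bits-differ : ∀ {i j} → i ≢ j → ∃ λ s → bit i s ≢ bit j s
  bits-differ {i} {j} i≢j = Fin.¬∀⟶∃¬ n _ (λ s → bit i s Fin.≟ bit j s) λ eq →
    i≢j (trans (sym (Fin.funToFin-finToFin {n} {2} i))
          (trans (funToFin-cong eq) (Fin.funToFin-finToFin {n} {2} j)))
    where
    funToFin-cong : ∀ {n m} {f g : Fin n → Fin m} → f ≗ g → funToFin f ≡ funToFin g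
    funToFin-cong {zero}  f≗g = refl
    funToFin-cong {suc n} f≗g = cong₂ combine (f≗g zero) (funToFin-cong (f≗g ∘ suc))

  toWalk : ∀ l (w : ℕ → Vertex) → (∀ p → p < l → w p ~ w (suc p)) → Walk graph (w 0) (w l) l
  toWalk zero    w e = []
  toWalk (suc l) w e = e 0 (s≤s z≤n) ∷ toWalk l (w ∘ suc) (λ p p<l → e (suc p) (s≤s p<l))

  module _ {i j : Fin (2 ^ n)} (a b : Fin m) {s : Fin n}
           (bᵢ : bit i s ≡ zero) (bⱼ : bit j s ≡ suc zero) where

    along : ℕ → Node
    along zero = inj₁ (i , a)
    along (suc p) with p <? κ
    ... | yes p<κ = inj₂ (s , (a , b) , fromℕ< p<κ)
    ... | no  _   = inj₁ (j , b)

    along-at : ∀ p → p ≤ k → At (along p) s a b p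
    along-at zero _ = inj₁ (refl , bᵢ , refl)
    along-at (suc p) p<k with p <? κ
    ... | yes p<κ = refl , refl , refl , cong suc (sym (Fin.toℕ-fromℕ< p<κ))
    ... | no  p≮κ = inj₂ (cong suc (ℕ.≤-antisym (s≤s⁻¹ p<k) (ℕ.≮⇒≥ p≮κ)) , bⱼ , refl)

    along-end : along k ≡ inj₁ (j , b)
    along-end with κ <? κ
    ... | yes κ<κ = contradiction κ<κ (ℕ.<-irrefl refl)
    ... | no  _   = refl

    leafWalk : Walk graph (leaf i a) (leaf j b) k
    leafWalk = subst (λ v → Walk graph (leaf i a) (from v) k) along-end (toWalk k (from ∘ along) edge)
      where
      edge : ∀ p → p < k → from (along p) ~ from (along (suc p))
      edge p p<k = subst₂ Edge (sym (strictlyInverseˡ _)) (sym (strictlyInverseˡ _))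
        (inj₁ (s , a , b , fromℕ< p<k ,
          subst (λ x → At (along p) s a b x × At (along (suc p)) s a b (suc x)) (sym (Fin.toℕ-fromℕ< p<k))
            (along-at p (ℕ.<⇒≤ p<k) , along-at (suc p) p<k)))

  leaf-walk : ∀ {i j} → i ≢ j → ∀ a b → Walk graph (leaf i a) (leaf j b) k
  leaf-walk {i} {j} i≢j a b with s , ne ← bits-differ i≢j
    with bit i s in bᵢ | bit j s in bⱼ
  ... | zero     | suc zero = leafWalk a b bᵢ bⱼ
  -- Paths are oriented from bit 0 to bit 1, so the path from `j` to `i` is reversed.
  ... | suc zero | zero     = reverse graph (leafWalk b a bⱼ bᵢ)
  ... | zero     | zero     = contradiction refl ne
  ... | suc zero | suc zero = contradiction refl ne

  -- A walk that changes the slot has to traverse some path completely, and if it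
  -- has length at most k then it is that path, so its ends differ in the bit s.
  module _ (i₀ : Fin (2 ^ n)) (a₀ : Fin m) where

    -- A necessary condition for being at position `p` after `l` steps from `(i₀ , a₀)`: the start
    -- is `p` steps away, the end `k - p` (written without subtraction), and nothing is claimed once
    -- `k < l`. Equality means that the path was entered at `(i₀ , a₀)` at once, which fixes a bit
    -- of `i₀`; strict inequality leaves time to enter at another leaf of slot `a₀`.
    Near : Fin n → Fin m → Fin m → ℕ → ℕ → Set
    Near s a b p l = (a ≡ a₀ × (p < l ⊎ (p ≤ l × bit i₀ s ≡ zero)))
                   ⊎ (b ≡ a₀ × (k < l + p ⊎ (k ≤ l + p × bit i₀ s ≡ suc zero)))
                   ⊎ k < l

    Reachable : Node → ℕ → Set
    Reachable (inj₁ (i , c)) l = (c ≡ a₀ × (i ≡ i₀ ⊎ 0 < l)) ⊎ (i ≢ i₀ × k ≤ l) ⊎ k < l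
    Reachable (inj₂ (s , (a , b) , t)) l = Near s a b (suc (toℕ t)) l

    late : ∀ v {l} → k < l → Reachable v l
    late (inj₁ _) k<l = inj₂ (inj₂ k<l)
    late (inj₂ _) k<l = inj₂ (inj₂ k<l)

    forward : ∀ {s a b p l} → Near s a b p l → Near s a b (suc p) (suc l)
    forward (inj₁ (a≡ , inj₁ p<l))              = inj₁ (a≡ , inj₁ (s≤s p<l))
    forward (inj₁ (a≡ , inj₂ (p≤l , b₀)))       = inj₁ (a≡ , inj₂ (s≤s p≤l , b₀))
    forward {p = p} {l} (inj₂ (inj₁ (b≡ , x)))  = inj₂ (inj₁ (b≡ , Sum.map up (λ (q , b₁) → up q , b₁) x))
      where
      up : ∀ {c} → c ≤ l + p → c ≤ suc l + suc p
      up c≤ = ℕ.≤-trans c≤ (ℕ.+-mono-≤ (ℕ.n≤1+n l) (ℕ.n≤1+n p))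
    forward (inj₂ (inj₂ k<l))                   = inj₂ (inj₂ (ℕ.m≤n⇒m≤1+n k<l))

    backward : ∀ {s a b p l} → Near s a b (suc p) l → Near s a b p (suc l)
    backward {l = l} (inj₁ (a≡ , x)) = inj₁ (a≡ , Sum.map down (λ (q , b₀) → down q , b₀) x)
      where
      down : ∀ {c} → suc c ≤ l → c ≤ suc l
      down c<l = ℕ.≤-trans (ℕ.<⇒≤ c<l) (ℕ.n≤1+n l)
    -- `l` rises as `p` falls, so `l + p` is unchanged.
    backward {s} {p = p} {l} (inj₂ (inj₁ (b≡ , x))) =
      inj₂ (inj₁ (b≡ , subst (λ e → k < e ⊎ (k ≤ e × bit i₀ s ≡ suc zero)) (ℕ.+-suc l p) x))
    backward (inj₂ (inj₂ k<l)) = inj₂ (inj₂ (ℕ.m≤n⇒m≤1+n k<l))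

    -- A leaf whose slot may have changed has already cost `k` steps; leaving it exceeds `k`, and
    -- `late` applies.
    depart : ∀ v {s a b p l} → At v s a b p → Reachable v l → Near s a b p l ⊎ k ≤ l
    depart (inj₁ _) (inj₁ (refl , b₀ , refl)) (inj₁ (a≡ , inj₁ refl)) = inj₁ (inj₁ (a≡ , inj₂ (z≤n , b₀)))
    depart (inj₁ _) (inj₁ (refl , b₀ , refl)) (inj₁ (a≡ , inj₂ 0<l))  = inj₁ (inj₁ (a≡ , inj₁ 0<l))
    depart (inj₁ _) {l = l} (inj₂ (refl , b₁ , refl)) (inj₁ (a≡ , inj₁ refl)) =
      inj₁ (inj₂ (inj₁ (a≡ , inj₂ (ℕ.m≤n+m k l , b₁))))
    depart (inj₁ _) {l = l} (inj₂ (refl , b₁ , refl)) (inj₁ (a≡ , inj₂ 0<l)) =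
      inj₁ (inj₂ (inj₁ (a≡ , inj₁ (ℕ.+-monoˡ-≤ k 0<l))))
    depart (inj₁ _) _ (inj₂ (inj₁ (_ , k≤l))) = inj₂ k≤l
    depart (inj₁ _) _ (inj₂ (inj₂ k<l))       = inj₂ (ℕ.<⇒≤ k<l)
    depart (inj₂ _) (refl , refl , refl , refl) near = inj₁ near

    -- If the opposite end is reached with no step to spare, the path was entered at `i₀`; its ends
    -- differ in bit `s`, so the new leaf has `i ≢ i₀`. With a step to spare, `k < suc l`.
    arrive : ∀ v {s a b p l} → At v s a b p → Near s a b p (suc l) → Reachable v (suc l)
    arrive (inj₁ _) (inj₁ (refl , b₀ , refl)) (inj₁ (a≡ , _)) = inj₁ (a≡ , inj₂ (s≤s z≤n))
    arrive (inj₁ _) {l = l} (inj₁ (refl , b₀ , refl)) (inj₂ (inj₁ (_ , inj₁ k<l))) =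
      inj₂ (inj₂ (subst (k <_) (ℕ.+-identityʳ (suc l)) k<l))
    arrive (inj₁ _) {l = l} (inj₁ (refl , b₀ , refl)) (inj₂ (inj₁ (_ , inj₂ (k≤l , b₁)))) =
      inj₂ (inj₁ ((λ { refl → Fin.0≢1+n (trans (sym b₀) b₁) }) ,
                  subst (k ≤_) (ℕ.+-identityʳ (suc l)) k≤l))
    arrive (inj₁ _) (inj₂ (refl , b₁ , refl)) (inj₁ (_ , inj₁ k<l)) = inj₂ (inj₂ k<l)
    arrive (inj₁ _) (inj₂ (refl , b₁ , refl)) (inj₁ (_ , inj₂ (k≤l , b₀))) =
      inj₂ (inj₁ ((λ { refl → Fin.0≢1+n (trans (sym b₀) b₁) }) , k≤l))
    arrive (inj₁ _) (inj₂ (refl , b₁ , refl)) (inj₂ (inj₁ (b≡ , _))) = inj₁ (b≡ , inj₂ (s≤s z≤n))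
    arrive (inj₁ _) _ (inj₂ (inj₂ k<l)) = inj₂ (inj₂ k<l)
    arrive (inj₂ _) (refl , refl , refl , refl) near = near

    edge-reachable : ∀ u v {l} → Edge u v → Reachable u l → Reachable v (suc l)
    edge-reachable u v (inj₁ (_ , _ , _ , _ , atᵤ , atᵥ)) ru with depart u atᵤ ru
    ... | inj₁ near = arrive v atᵥ (forward near)
    ... | inj₂ k≤l  = late v (s≤s k≤l)
    edge-reachable u v (inj₂ (_ , _ , _ , _ , atᵥ , atᵤ)) ru with depart u atᵤ ru
    ... | inj₁ near = arrive v atᵥ (backward near)
    ... | inj₂ k≤l  = late v (s≤s k≤l)

    walk-reachable : ∀ {u v l₀ l} → Walk graph u v l → Reachable (to u) l₀ → Reachable (to v) (l + l₀)
    walk-reachable [] ru = ru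
    walk-reachable {v = v} {l₀} {suc l} (_∷_ {u} {w} e p) ru =
      subst (Reachable (to v)) (ℕ.+-suc l l₀)
        (walk-reachable p (edge-reachable (to u) (to w) e ru))

  -- Both ends have the same `i`, which excludes the alternative `i ≢ i₀` of the invariant, and the
  -- distance bound excludes `k < d`.
  same-slot : ∀ {u v i a b} → to u ≡ inj₁ (i , a) → to v ≡ inj₁ (i , b) →
              DistanceAtMost graph k u v → a ≡ b
  same-slot {u} {v} {i} {a} {b} uᵢ vᵢ (d , (walk , _) , d≤k)
    with subst₂ (Reachable i a) vᵢ (ℕ.+-identityʳ d)
           (walk-reachable i a walk (subst (λ x → Reachable i a x 0) (sym uᵢ) (inj₁ (refl , inj₁ refl))))
  ... | inj₁ (b≡a , _)        = sym b≡a
  ... | inj₂ (inj₁ (i≢i , _)) = contradiction refl i≢i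
  ... | inj₂ (inj₂ k<d)       = contradiction d≤k (ℕ.<⇒≱ k<d)

  leaves-adjacent : ∀ {i j} → i ≢ j → ∀ a b → Graph._~_ (graph ^ᵍ k) (leaf i a) (leaf j b)
  leaves-adjacent i≢j a b = distinct , walk⇒distanceAtMost graph (leaf-walk i≢j a b) ℕ.≤-refl
    where
    distinct : leaf _ a ≢ leaf _ b
    distinct eq = i≢j (cong proj₁ (inj₁-injective (Injection.injective (↔⇒↣ (↔-sym node↔)) eq)))

  -- Each part is independent by `same-slot` and gets one color; every inner path vertex gets a
  -- color of its own.
  power-colorable : Colorable (graph ^ᵍ k) (2 ^ n + #links)
  power-colorable = Inverse.from Fin.+↔⊎ ∘ color ∘ to , λ u v (u≢v , near) eq →
    u≢v (to-injective (proper u v refl refl near (Injection.injective (↔⇒↣ (↔-sym Fin.+↔⊎)) eq)))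
    where
    color : Node → Fin (2 ^ n) ⊎ Fin #links
    color = Sum.map proj₁ (Inverse.from link↔)

    proper : ∀ u v {x y} → to u ≡ x → to v ≡ y → DistanceAtMost graph k u v →
             color x ≡ color y → x ≡ y
    proper u v {inj₁ _} {inj₁ _} u≡ v≡ near refl = cong (λ a → inj₁ (_ , a)) (same-slot u≡ v≡ near)
    proper u v {inj₂ x} {inj₂ y} _ _ _ eq =
      cong inj₂ (Injection.injective (↔⇒↣ (↔-sym link↔)) (inj₂-injective eq))

-- Upper bounds for the logarithm.

0≤recip : ∀ n → 0ℚ ℚ.≤ recip n
0≤recip n = ℚ.<⇒≤ (ℚ.positive⁻¹ (recip n) {{ℚ.normalize-pos 1 (suc n)}})

sum-nonneg : ∀ n {f} → (∀ i → 0ℚ ℚ.≤ f i) → 0ℚ ℚ.≤ sum n f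
sum-nonneg zero    h = ℚ.≤-refl
sum-nonneg (suc n) h = ℚ.+-mono-≤ (sum-nonneg n h) (h n)

sum-extend : ∀ {a b} f → (∀ i → 0ℚ ℚ.≤ f i) → a ≤ b → sum a f ℚ.≤ sum b f
sum-extend {a} {b} f h a≤b = begin
  sum a f                                      ≡⟨ ℚ.+-identityʳ (sum a f) ⟨
  sum a f ℚ.+ 0ℚ                               ≤⟨ ℚ.+-monoʳ-≤ (sum a f) (sum-nonneg (b ∸ a) (h ∘ (_+_ a))) ⟩
  sum a f ℚ.+ sum (b ∸ a) (λ i → f (a + i))    ≡⟨ sum-+ a (b ∸ a) f ⟨
  sum (a + (b ∸ a)) f                          ≡⟨ cong (λ n → sum n f) (ℕ.m+[n∸m]≡n a≤b) ⟩
  sum b f                                      ∎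
  where open ℚ.≤-Reasoning

logSum-mono : ∀ {a b} m → a ≤ b → logSum a m ℚ.≤ logSum b m
logSum-mono m a≤b = sum-extend (λ i → recip (suc m + i)) (λ i → 0≤recip (suc m + i))
  (ℕ.*-monoˡ-≤ (suc m) (ℕ.∸-monoˡ-≤ 1 a≤b))

-- Between `n + 1` and `2(n + 1)` the integrand `1/t` is at most `1/(n + 1)`. In the sum these are
-- `N + 1 = (n + 1)(m + 1)` further terms, each at most `1/(N + 1)`.
logSum-double : ∀ n m → logSum (2 * suc n) m ℚ.≤ logSum (suc n) m ℚ.+ 1ℚ
logSum-double n m = begin
  logSum (2 * suc n) m
    ≡⟨ cong (λ l → sum l f) length≡ ⟩
  sum (n * suc m + suc N) f
    ≡⟨ sum-+ (n * suc m) (suc N) f ⟩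
  logSum (suc n) m ℚ.+ sum (suc N) (λ i → f (n * suc m + i))
    ≤⟨ ℚ.+-monoʳ-≤ (logSum (suc n) m) (sum-mono (suc N) λ i _ → recip-anti (bound i)) ⟩
  -- The shape `0 + N * 1` matches `*-recip N 0`.
  logSum (suc n) m ℚ.+ sum (suc N) (λ _ → recip (0 + N * 1))
    ≡⟨ cong (logSum (suc n) m ℚ.+_) (trans (sum-const (suc N) _) (*-recip N 0)) ⟩
  logSum (suc n) m ℚ.+ 1ℚ ∎
  where
  open ℚ.≤-Reasoning
  f : ℕ → ℚ
  f i = recip (suc m + i)

  N : ℕ
  N = m + n * suc m

  length≡ : (2 * suc n ∸ 1) * suc m ≡ n * suc m + suc N
  length≡ = trans (cong (λ e → (n + e) * suc m) (ℕ.+-identityʳ (suc n)))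
                  (ℕ.*-distribʳ-+ (suc m) n (suc n))

  bound : ∀ i → 0 + N * 1 ≤ suc m + (n * suc m + i)
  bound i = ℕ.≤-trans (ℕ.≤-reflexive (ℕ.*-identityʳ N))
    (ℕ.+-mono-≤ (ℕ.n≤1+n m) (ℕ.m≤m+n (n * suc m) i))

-- Each doubling adds at most 1. Replacing `log 2` by 1 affects only the constant.
logSum-2^ : ∀ e m → logSum (2 ^ e) m ℚ.≤ + e / 1
logSum-2^ e m = ℚ.≤-trans (bound e)
  (ℚ.≤-reflexive (trans (sum-const e 1ℚ) (ℚ.*-identityʳ (+ e / 1))))
  where
  bound : ∀ e → logSum (2 ^ e) m ℚ.≤ sum e (λ _ → 1ℚ)
  bound zero = ℚ.≤-refl
  bound (suc e) with 2 ^ e | ℕ.m^n>0 2 e | bound e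
  ... | suc n | _ | ih = ℚ.≤-trans (logSum-double n m) (ℚ.+-monoˡ-≤ 1ℚ ih)

-- The members below have χ ≤ 4q, log χ ≤ 7h and χℓ > h q, which gives 1 / (4 · 7).
c : ℚ
c = + 1 / 28

scale-≤ : ∀ a e b → a * e ≤ 28 * b → (c ℚ.* (+ a / 1)) ℚ.* (+ e / 1) ℚ.≤ + b / 1
scale-≤ a e b h = ℚ.toℚᵘ-cancel-≤ (begin
  ℚ.toℚᵘ ((c ℚ.* (+ a / 1)) ℚ.* (+ e / 1))
    ≃⟨ ℚ.toℚᵘ-homo-* (c ℚ.* (+ a / 1)) (+ e / 1) ⟩
  ℚ.toℚᵘ (c ℚ.* (+ a / 1)) ℚᵘ.* ℚ.toℚᵘ (+ e / 1)
    ≃⟨ ℚᵘ.*-cong (ℚᵘ.≃-trans (ℚ.toℚᵘ-homo-* c (+ a / 1)) (ℚᵘ.*-congˡ {ℚ.toℚᵘ c} (cast a))) (cast e) ⟩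
  (ℚ.toℚᵘ c ℚᵘ.* ℚᵘ.mkℚᵘ (+ a) 0) ℚᵘ.* ℚᵘ.mkℚᵘ (+ e) 0
    ≤⟨ ℚᵘ.*≤* cross ⟩
  ℚᵘ.mkℚᵘ (+ b) 0
    ≃⟨ cast b ⟨
  ℚ.toℚᵘ (+ b / 1) ∎)
  where
  open ℚᵘ.≤-Reasoning
  cast : ∀ x → ℚ.toℚᵘ (+ x / 1) ℚᵘ.≃ ℚᵘ.mkℚᵘ (+ x) 0
  cast x = ℚ.toℚᵘ-fromℚᵘ (ℚᵘ.mkℚᵘ (+ x) 0)

  cross : (+ 1 ℤ.* + a) ℤ.* + e ℤ.* + 1 ℤ.≤ + b ℤ.* + 28
  cross = subst₂ ℤ._≤_
    (trans (ℤ.pos-* a e) (trans (cong (ℤ._* + e) (sym (ℤ.*-identityˡ (+ a)))) (sym (ℤ.*-identityʳ _))))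
    (trans (cong +_ (ℕ.*-comm 28 b)) (ℤ.pos-* b 28))
    (ℤ.+≤+ h)

n<2^n : ∀ n → n < 2 ^ n
n<2^n zero    = s≤s z≤n
n<2^n (suc n) = ℕ.≤-trans (ℕ.+-mono-≤ (ℕ.m^n>0 2 n) (n<2^n n))
  (ℕ.≤-reflexive (cong (_+_ (2 ^ n)) (sym (ℕ.+-identityʳ (2 ^ n)))))

-- Choice of parameters and the resulting inequalities.

module Member (κ h : ℕ) (large : 6 * suc κ ≤ h) where

  n q : ℕ
  n = 6 * h
  -- With half of `2 ^ n`, the palette has `h * 2 ^ n` colors, fewer than the `(h + 1) * 2 ^ n` that
  -- the parts require.
  q = 2 ^ (n ∸ 1)

  open PathGraph n (2 ^ (h + h)) κ public
  open BlockLists q h using (Slot; chromatic-lower; not-choosable)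

  0<h : 0 < h
  0<h = ℕ.≤-trans (s≤s z≤n) large

  2q≡2^n : 2 * q ≡ 2 ^ n
  2q≡2^n = cong (2 ^_) (ℕ.m+[n∸m]≡n (ℕ.≤-trans 0<h (ℕ.m≤m+n h (5 * h))))

  -- `#links` is `6h * 16 ^ h * κ` and `2 ^ n` is `16 ^ h * 4 ^ h`; the factor `4 ^ h` absorbs
  -- `6κ * h`, as `6κ` and `h` are each at most `2 ^ h`.
  links-few : #links ≤ 2 ^ n
  links-few = begin
    n * (2 ^ (h + h) * 2 ^ (h + h) * κ)   ≡⟨ cong (λ y → n * (y * y * κ)) (ℕ.^-distribˡ-+-* 2 h h) ⟩
    6 * h * (X * X * (X * X) * κ)         ≡⟨ rearrange h X κ ⟩
    6 * κ * h * (X * X * (X * X))         ≤⟨ ℕ.*-monoˡ-≤ (X * X * (X * X)) (ℕ.*-mono-≤ 6κ≤X h≤X) ⟩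
    X * X * (X * X * (X * X))             ≡⟨ sixth X ⟩
    X ^ 6                                 ≡⟨ ℕ.^-*-assoc 2 h 6 ⟩
    2 ^ (h * 6)                           ≡⟨ cong (2 ^_) (ℕ.*-comm h 6) ⟩
    2 ^ n                                 ∎
    where
    open ℕ.≤-Reasoning
    X : ℕ
    X = 2 ^ h

    h≤X : h ≤ X
    h≤X = ℕ.<⇒≤ (n<2^n h)

    6κ≤X : 6 * κ ≤ X
    6κ≤X = ℕ.≤-trans (ℕ.*-monoʳ-≤ 6 (ℕ.n≤1+n κ)) (ℕ.≤-trans large h≤X)

    open +-*-Solver
    rearrange : ∀ h X κ → 6 * h * (X * X * (X * X) * κ) ≡ 6 * κ * h * (X * X * (X * X))
    rearrange = solve 3 (λ h X κ → con 6 :* h :* (X :* X :* (X :* X) :* κ)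
                                := con 6 :* κ :* h :* (X :* X :* (X :* X))) refl
    sixth : ∀ X → X * X * (X * X * (X * X)) ≡ X ^ 6
    sixth = solve 1 (λ X → X :* X :* (X :* X :* (X :* X)) := X :^ 6) refl

  d : Slot
  d = fromℕ< (ℕ.m^n>0 2 (h + h))

  χ-lower : 2 ^ n ≤ χ (graph ^ᵍ k)
  χ-lower = chromatic-lower (graph ^ᵍ k) (2 ^ n) leaf (slot d) (slot-leaf d) leaves-adjacent d
              (proj₁ (χ-isLeast (graph ^ᵍ k)))

  χ-upper : χ (graph ^ᵍ k) ≤ 2 ^ suc n
  χ-upper = ℕ.≤-trans (proj₂ (χ-isLeast (graph ^ᵍ k)) _ power-colorable)
    (ℕ.+-monoʳ-≤ (2 ^ n) (ℕ.≤-trans links-few (ℕ.m≤m+n (2 ^ n) 0)))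

  -- `not-choosable` treats every list size up to `h * q`, so it applies directly to the size `χℓ`.
  χℓ-lower : h * q < χℓ (graph ^ᵍ k)
  χℓ-lower = ℕ.≰⇒> λ χℓ≤ →
    not-choosable (graph ^ᵍ k) (2 ^ n) leaf (slot d) (slot-leaf d) leaves-adjacent χℓ≤ few-colors
      (proj₁ (χℓ-isLeast (graph ^ᵍ k)))
    where
    few-colors : (h + h) * q < 2 ^ n * suc h
    few-colors = begin-strict
      (h + h) * q      ≡⟨ double h q ⟩
      2 * q * h        ≡⟨ cong (_* h) 2q≡2^n ⟩
      2 ^ n * h        <⟨ ℕ.*-monoʳ-< (2 ^ n) {{ℕ.m^n≢0 2 n}} (ℕ.n<1+n h) ⟩
      2 ^ n * suc h    ∎
      where
      open ℕ.≤-Reasoning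
      open +-*-Solver
      double : ∀ h q → (h + h) * q ≡ 2 * q * h
      double = solve 2 (λ h q → (h :+ h) :* q := con 2 :* q :* h) refl

  χ·log≤28χℓ : χ (graph ^ᵍ k) * suc n ≤ 28 * χℓ (graph ^ᵍ k)
  χ·log≤28χℓ = begin
    χ (graph ^ᵍ k) * suc n        ≤⟨ ℕ.*-mono-≤ χ-upper (ℕ.+-monoˡ-≤ n 0<h) ⟩
    2 * 2 ^ n * (h + 6 * h)       ≡⟨ cong (λ y → 2 * y * (h + 6 * h)) 2q≡2^n ⟨
    2 * (2 * q) * (h + 6 * h)     ≡⟨ rearrange h q ⟩
    28 * (h * q)                  ≤⟨ ℕ.*-monoʳ-≤ 28 (ℕ.<⇒≤ χℓ-lower) ⟩
    28 * χℓ (graph ^ᵍ k)          ∎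
    where
    open ℕ.≤-Reasoning
    open +-*-Solver
    rearrange : ∀ h q → 2 * (2 * q) * (h + 6 * h) ≡ 28 * (h * q)
    rearrange = solve 2 (λ h q → con 2 :* (con 2 :* q) :* (h :+ con 6 :* h) := con 28 :* (h :* q)) refl

  -- Growth with `h` gives unboundedness and, through `h<order`, infinitely many isomorphism types.
  h<χ : h < χ (graph ^ᵍ k)
  h<χ = begin-strict
    h                 ≤⟨ ℕ.m≤m+n h (5 * h) ⟩
    n                 <⟨ n<2^n n ⟩
    2 ^ n             ≤⟨ χ-lower ⟩
    χ (graph ^ᵍ k)    ∎
    where open ℕ.≤-Reasoning

  h<order : h < Graph.order graph
  h<order = ℕ.≤-trans h<χ (proj₂ (χ-isLeast (graph ^ᵍ k)) _ (colorable-order (graph ^ᵍ k)))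

  list-bound : fromℕ (χℓ (graph ^ᵍ k)) ≥ʳ fromℚ c *ʳ fromℕ (χ (graph ^ᵍ k)) *ʳ log (χ (graph ^ᵍ k))
  -- The inequality holds for every Riemann sum, so index 0 suffices and `ε` is mere slack.
  list-bound ε 0<ε = 0 , λ j _ → begin
    C ℚ.* logSum (χ (graph ^ᵍ k)) j
      ≤⟨ ℚ.*-monoˡ-≤-nonNeg C {{C-nonNeg}} (ℚ.≤-trans (logSum-mono j χ-upper) (logSum-2^ (suc n) j)) ⟩
    C ℚ.* (+ suc n / 1)
      ≤⟨ scale-≤ (χ (graph ^ᵍ k)) (suc n) (χℓ (graph ^ᵍ k)) χ·log≤28χℓ ⟩
    + χℓ (graph ^ᵍ k) / 1
      ≡⟨ ℚ.+-identityʳ _ ⟨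
    + χℓ (graph ^ᵍ k) / 1 ℚ.+ 0ℚ
      ≤⟨ ℚ.+-monoʳ-≤ (+ χℓ (graph ^ᵍ k) / 1) (ℚ.<⇒≤ 0<ε) ⟩
    + χℓ (graph ^ᵍ k) / 1 ℚ.+ ε ∎
    where
    open ℚ.≤-Reasoning
    C : ℚ
    C = c ℚ.* (+ χ (graph ^ᵍ k) / 1)

    C-nonNeg : ℚ.NonNegative C
    C-nonNeg = ℚ.nonNeg*nonNeg⇒nonNeg c (+ χ (graph ^ᵍ k) / 1)
      {{ℚ.normalize-nonNeg (χ (graph ^ᵍ k)) 1}}

-- The infinite family.

Family : ℕ → Pred Graph (lsuc 0ℓ)
Family κ G = ∃ λ h → ∃ λ large → G ≡ Member.graph κ h large

large-member : ∀ κ N → ∃ λ h → 6 * suc κ ≤ h × N ≤ h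
large-member κ N = 6 * suc κ + N , ℕ.m≤m+n (6 * suc κ) N , ℕ.m≤n+m N (6 * suc κ)

≅⇒order≤ : ∀ G H → G ≅ H → Graph.order G ≤ Graph.order H
≅⇒order≤ G H (φ , _) = Fin.injective⇒≤ (Bijection.injective φ)

family-infinite : ∀ κ → InfiniteFamily (Family κ)
-- With `h` at least every listed order, the member has more vertices than each listed graph.
family-infinite κ Hs with h , large , N≤h ← large-member κ (max 0 (map Graph.order Hs)) =
  graph , (h , large , refl) , All.map (λ {H} → not-iso H) (map⁻ (xs≤max 0 (map Graph.order Hs)))
  where
  open Member κ h large

  not-iso : ∀ H → Graph.order H ≤ max 0 (map Graph.order Hs) → ¬ (graph ≅ H)
  not-iso H small iso = ℕ.<⇒≱ h<order (ℕ.≤-trans (≅⇒order≤ graph H iso) (ℕ.≤-trans small N≤h))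

family-unbounded : ∀ κ → Unbounded (λ n → ∃[ G ] (Family κ G × n ≡ χ (G ^ᵍ suc κ)))
family-unbounded κ N with h , large , N≤h ← large-member κ N =
  χ (graph ^ᵍ suc κ) , (graph , (h , large , refl) , refl) , ℕ.≤-<-trans N≤h h<χ
  where open Member κ h large

theorem3p4 : ∃[ c ] (0ℝ <ʳ c ×
    (∀ (k : ℕ) → 1 ≤ k →
    ∃ λ (𝒢 : Pred Graph (lsuc 0ℓ)) →
    InfiniteFamily 𝒢 ×
    Unbounded (λ n → ∃[ G ] (𝒢 G × n ≡ χ (G ^ᵍ k))) ×
    (∀ G → 𝒢 G →
    fromℕ (χℓ (G ^ᵍ k)) ≥ʳ c *ʳ fromℕ (χ (G ^ᵍ k)) *ʳ log (χ (G ^ᵍ k)))))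
theorem3p4 = fromℚ c , (c , ℚ.positive⁻¹ c , 0 , λ _ _ → ℚ.≤-reflexive (ℚ.+-identityˡ c)) , λ
  { (suc κ) _ → Family κ , family-infinite κ , family-unbounded κ ,
      λ { _ (h , large , refl) → Member.list-bound κ h large } }
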